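{- Let $A$ be a reduced ring. Then $A^\sim$ is a field in the sense that $$1 \models \forall x{:}A^\sim.\ \bigl((\neg(\exists y{:}A^\sim.\ xy = 1)) \Rightarrow x = 0\bigr).$$
   Context: The metatheory is constructive (no law of excluded middle, no axiom of choice). A ring is a commutative ring with unit (possibly trivial); it is reduced iff $x^n=0$ implies $x=0$. For $f\in A$, $A[f^{ -1}]$ denotes the localization at $\{1,f,f^2,\ldots\}$; it is the zero ring iff $f$ is nilpotent. A formula over a ring element $f\in A$ is a first-order formula over the signature with a sort $A^\sim$, function symbols for the ring structure, and a constant of sort $A^\sim$ for each element of $A[f^{ -1}]$. The relation $f\models\varphi$ (sheaf semantics of the spectrum of $A$, in its explicit algebraic form) is defined by recursion on $\varphi$: - $f\models\top$ iff true; $f\models\bot$ iff $f$ is nilpotent; - $f\models x=y$ iff $x=y$ in $A[f^{ -1}]$; - $f\models\varphi\wedge\psi$ iff $f\models\varphi$ and $f\models\psi$; - $f\models\varphi\vee\psi$ iff there exists a partition $f^n=fg_1+\cdots+fg_m$ such that for each $i$, $fg_i\models\varphi$ or $fg_i\models\psi$; - $f\models\varphi\Rightarrow\psi$ iff for all $g\in A$, $fg\models\varphi$ implies $fg\models\psi$; - $f\models\forall x{:}A^\sim.\,\varphi(x)$ iff for all $g\in A$ and all $x_0\in A[(fg)^{ -1}]$, $fg\models\varphi(x_0)$; - $f\models\exists x{:}A^\sim.\,\varphi(x)$ iff there exists a partition $f^n=fg_1+\cdots+fg_m$ such that for each $i$, $fg_i\models\varphi(x_0)$ for some $x_0\in A[(fg_i)^{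 -1}]$. Here, in writing $fg\models\varphi$ for a formula $\varphi$ over $f$, constants in $A[f^{ -1}]$ are replaced by their images in $A[(fg)^{ -1}]$. $\neg\varphi$ abbreviates $\varphi\Rightarrow\bot$. -}

module Defs where

open import Algebra.Bundles using (CommutativeRing)
open import Data.Fin.Base using (Fin)
open import Data.Nat.Base as ℕ using (ℕ; suc)
open import Data.Product.Base using (Σ; ∃; _×_)
open import Data.Sum.Base using (_⊎_)
open import Data.Unit.Polymorphic.Base using (⊤)
open import Data.Vec.Functional using (Vector; []; _∷_)
open import Function.Base using (id; _∘_)
open import Level using (Level; Lift; _⊔_)

private
  variable
    a : Level

infixl 9 _‵*_
infixl 8 _‵+_
infix  7 _≐_
infixr 6 _‵∧_
infixr 5 _‵∨_
infixr 4 _‵⇒_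
infix  9 ‵¬_

-- First-order formulas over the signature of rings, with constants from C.
-- The number n bounds the free variables, which are de Bruijn indices.

data Term (C : Set a) (n : ℕ) : Set a where
  var   : Fin n → Term C n
  const : C → Term C n
  ‵0 ‵1 : Term C n
  ‵-_   : Term C n → Term C n
  _‵+_  : Term C n → Term C n → Term C n
  _‵*_  : Term C n → Term C n → Term C n

data Formula (C : Set a) (n : ℕ) : Set a where
  ‵⊤ ‵⊥ : Formula C n
  _≐_   : Term C n → Term C n → Formula C n
  _‵∧_  : Formula C n → Formula C n → Formula C n
  _‵∨_  : Formula C n → Formula C n → Formula C n
  _‵⇒_  : Formula C n → Formula C n → Formula C n
  ‵∀_   : Formula C (suc n) → Formula C n
  ‵∃_   : Formula C (suc n) → Formula C n

‵¬_ : {C : Set a} {n : ℕ} → Formula C n → Formula C n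
‵¬ φ = φ ‵⇒ ‵⊥

module SheafSemantics {c ℓ} (A : CommutativeRing c ℓ) where
  open CommutativeRing A
  open import Algebra.Properties.Semiring.Exp semiring using (_^_)
  open import Algebra.Properties.Semiring.Sum semiring using (sum)

  Nilpotent : Carrier → Set ℓ
  Nilpotent f = ∃ λ n → f ^ n ≈ 0#

  Reduced : Set (c ⊔ ℓ)
  Reduced = ∀ x n → x ^ n ≈ 0# → x ≈ 0#

  infix 9 _/^_

  -- The localization A[f⁻¹], as a setoid: p /^ n is the fraction p / fⁿ.
  record Loc (f : Carrier) : Set c where
    constructor _/^_
    field
      num : Carrier
      exp : ℕ

  module _ {f : Carrier} where

    infix  4 _≈ₗ_
    infixl 6 _+ₗ_
    infixl 7 _*ₗ_
    infix  8 -ₗ_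

    _≈ₗ_ : Loc f → Loc f → Set ℓ
    (p /^ m) ≈ₗ (q /^ n) = ∃ λ k → f ^ k * (p * f ^ n) ≈ f ^ k * (q * f ^ m)

    0ₗ 1ₗ : Loc f
    0ₗ = 0# /^ 0
    1ₗ = 1# /^ 0

    -ₗ_ : Loc f → Loc f
    -ₗ (p /^ m) = (- p) /^ m

    _+ₗ_ _*ₗ_ : Loc f → Loc f → Loc f
    (p /^ m) +ₗ (q /^ n) = (p * f ^ n + q * f ^ m) /^ (m ℕ.+ n)
    (p /^ m) *ₗ (q /^ n) = (p * q) /^ (m ℕ.+ n)

    -- The localization map A[f⁻¹] → A[(fg)⁻¹]: p / fⁿ = p gⁿ / (fg)ⁿ.
    res : (g : Carrier) → Loc f → Loc (f * g)
    res g (p /^ n) = (p * g ^ n) /^ n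

  -- A partition fⁿ = f g₁ + ⋯ + f gₘ (m = 0 is allowed).
  record Partition (f : Carrier) : Set (c ⊔ ℓ) where
    field
      n m  : ℕ
      part : Vector Carrier m
      eq   : f ^ n ≈ sum (λ i → f * part i)

  module _ {C : Set a} where

    eval : ∀ {n f} → (C → Loc f) → Vector (Loc f) n → Term C n → Loc f
    eval ι ρ (var i)   = ρ i
    eval ι ρ (const x) = ι x
    eval ι ρ ‵0        = 0ₗ
    eval ι ρ ‵1        = 1ₗ
    eval ι ρ (‵- s)    = -ₗ eval ι ρ s
    eval ι ρ (s ‵+ t)  = eval ι ρ s +ₗ eval ι ρ t
    eval ι ρ (s ‵* t)  = eval ι ρ s *ₗ eval ι ρ t

    -- Forces f ι ρ φ says that f forces the closed formula obtained from φ by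
    -- replacing each constant x by ι x and each free variable i by ρ i.
    -- Replacing the elements of A[f⁻¹] occurring in a formula by their images
    -- in A[(fg)⁻¹] is composing ι and ρ with res g; carrying ι and ρ along
    -- instead of rewriting φ keeps the recursion structural.
    Forces : ∀ {n} (f : Carrier) → (C → Loc f) → Vector (Loc f) n →
             Formula C n → Set (c ⊔ ℓ)
    Forces f ι ρ ‵⊤       = ⊤
    Forces f ι ρ ‵⊥       = Lift c (Nilpotent f)
    Forces f ι ρ (s ≐ t)  = Lift c (eval ι ρ s ≈ₗ eval ι ρ t)
    Forces f ι ρ (φ ‵∧ ψ) = Forces f ι ρ φ × Forces f ι ρ ψ
    Forces f ι ρ (φ ‵∨ ψ) =
      Σ (Partition f) λ P → let open Partition P in
        ∀ i → Forces (f * part i) (res (part i) ∘ ι) (res (part i) ∘ ρ) φ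
            ⊎ Forces (f * part i) (res (part i) ∘ ι) (res (part i) ∘ ρ) ψ
    Forces f ι ρ (φ ‵⇒ ψ) =
      ∀ g → Forces (f * g) (res g ∘ ι) (res g ∘ ρ) φ →
            Forces (f * g) (res g ∘ ι) (res g ∘ ρ) ψ
    Forces f ι ρ (‵∀ φ)   =
      ∀ g (x₀ : Loc (f * g)) → Forces (f * g) (res g ∘ ι) (x₀ ∷ (res g ∘ ρ)) φ
    Forces f ι ρ (‵∃ φ)   =
      Σ (Partition f) λ P → let open Partition P in
        ∀ i → Σ (Loc (f * part i)) λ x₀ →
          Forces (f * part i) (res (part i) ∘ ι) (x₀ ∷ (res (part i) ∘ ρ)) φ

  infix 3 _⊨_

  _⊨_ : (f : Carrier) → Formula (Loc f) 0 → Set (c ⊔ ℓ)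
  f ⊨ φ = Forces f id [] φ

{-# OPTIONS --safe #-}

-- The fraction x = p / fⁿ becomes invertible on the open set
-- D(f p). So if f forces x to be non-invertible, then f p is nilpotent, hence
-- zero as A is reduced, and f p = 0 says that x = 0 in A[f⁻¹].
module Submission where

open import Defs
open import Algebra.Bundles using (CommutativeRing)
import Algebra.Properties.CommutativeSemiring.Exp as CommutativeExp
import Algebra.Properties.Semiring.Exp as Exp
open import Data.Fin.Base using (Fin; suc)
open import Data.Fin.Patterns using (0F; 1F)
open import Data.Nat.Base as ℕ using (ℕ)
import Data.Nat.Properties as ℕ
open import Data.Product.Base using (_,_)
open import Data.Vec.Functional using (Vector; []; _∷_)
open import Function.Base using (_∘_)
open import Level using (lift)
open import Relation.Binary.PropositionalEquality using (cong)
import Relation.Binary.Reasoning.Setoid as SetoidReasoning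

module _ {c ℓ} (A : CommutativeRing c ℓ) where
  open CommutativeRing A
  open SheafSemantics A
  open Loc
  open Exp semiring using (_^_; ^-congˡ)
  open CommutativeExp commutativeSemiring using (^-distrib-*)
  open SetoidReasoning setoid

  -- Lets a single global witness serve for `‵∃`, at the price of passing from `f` to `f * 1#`.
  trivialPartition : ∀ f → Partition f
  trivialPartition f = record
    { n    = 1
    ; m    = 1
    ; part = λ _ → 1#
    ; eq   = sym (+-identityʳ (f * 1#))
    }

  forces-invertible : ∀ {a} {C : Set a} {n} {f} (ι : C → Loc f)
    (ρ : Vector (Loc f) n) (i : Fin n) → let p = num (ρ i) in
    Forces (f * p) (res p ∘ ι) (res p ∘ ρ) (‵∃ (var (suc i) ‵* var 0F ≐ ‵1))
  forces-invertible {f = f} ι ρ i =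
    -- The inverse of p / fⁿ is fⁿ / p, expanded by f to fⁿ⁺¹ / (f p) so that the denominator is a
    -- power of f p. The product equals 1 already after cross-multiplying, hence the exponent `0`.
    trivialPartition (f * p) , λ _ → ((f ^ ℕ.suc n) /^ 1) , lift (0 , *-congˡ (begin
      p * p ^ n * 1# ^ n * f ^ ℕ.suc n * 1#  ≈⟨ *-identityʳ _ ⟩
      p * p ^ n * 1# ^ n * f ^ ℕ.suc n       ≈⟨ *-congʳ (*-assoc p (p ^ n) (1# ^ n)) ⟩
      p * (p ^ n * 1# ^ n) * f ^ ℕ.suc n     ≈⟨ *-congʳ (*-congˡ (^-distrib-* p 1# n)) ⟨
      p * (p * 1#) ^ n * f ^ ℕ.suc n         ≈⟨ *-congʳ (*-congˡ (^-congˡ n (*-identityʳ p))) ⟩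
      p ^ ℕ.suc n * f ^ ℕ.suc n              ≈⟨ *-comm _ _ ⟩
      f ^ ℕ.suc n * p ^ ℕ.suc n              ≈⟨ ^-distrib-* f p (ℕ.suc n) ⟨
      (f * p) ^ ℕ.suc n                      ≈⟨ ^-congˡ (ℕ.suc n) (*-identityʳ (f * p)) ⟨
      (f * p * 1#) ^ ℕ.suc n                 ≡⟨ cong ((f * p * 1#) ^_) (ℕ.+-comm 1 n) ⟩
      (f * p * 1#) ^ (n ℕ.+ 1)               ≈⟨ *-identityˡ _ ⟨
      1# * (f * p * 1#) ^ (n ℕ.+ 1)          ∎))
    where
    p = num (ρ i)
    n = exp (ρ i)

  f*num≈0⇒≈0ₗ : ∀ {f} (x : Loc f) → f * num x ≈ 0# → x ≈ₗ 0ₗ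
  -- The exponent `1` supplies the factor f that turns p into f p; exponent `0` would demand p = 0.
  f*num≈0⇒≈0ₗ {f} (p /^ n) fp≈0 = 1 , (begin
    f * 1# * (p * 1#)      ≈⟨ *-cong (*-identityʳ f) (*-identityʳ p) ⟩
    f * p                  ≈⟨ fp≈0 ⟩
    0#                     ≈⟨ zeroʳ (f * 1#) ⟨
    f * 1# * 0#            ≈⟨ *-congˡ (zeroˡ (f ^ n)) ⟨
    f * 1# * (0# * f ^ n)  ∎)

  forces-nonInvertible⇒≈0 : Reduced → ∀ {a} {C : Set a} {n} {f} (ι : C → Loc f)
    (ρ : Vector (Loc f) n) (i : Fin n) →
    Forces f ι ρ (‵¬ (‵∃ (var (suc i) ‵* var 0F ≐ ‵1))) →
    Forces f ι ρ (var i ≐ ‵0)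
  forces-nonInvertible⇒≈0 reduced ι ρ i nonInvertible
    -- Taking the numerator p as the test element of the implication, `‵⊥` at stage f p yields (f
    -- p)ᵏ = 0.
    with nonInvertible (num (ρ i)) (forces-invertible ι ρ i)
  ... | lift (k , [fp]^k≈0) = lift (f*num≈0⇒≈0ₗ (ρ i) (reduced _ k [fp]^k≈0))

proposition47 : ∀ {c ℓ} (A : CommutativeRing c ℓ) →
    let open CommutativeRing A using (1#)
        open SheafSemantics A
    in Reduced →
       1# ⊨ ‵∀ ((‵¬ (‵∃ (var 1F ‵* var 0F ≐ ‵1))) ‵⇒ (var 0F ≐ ‵0))
proposition47 A reduced g x₀ h =
  -- `g` comes from `‵∀` and `h` from `‵⇒`, so the element tested is the restriction of `x₀` to
  -- stage `1# * g * h`.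
  forces-nonInvertible⇒≈0 A reduced
    (res h ∘ res g) (res h ∘ (x₀ ∷ (res g ∘ []))) 0F
  where open SheafSemantics A using (res)
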